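{- A graph $G$ is a $2$-$\chi_i$-game-vertex-critical graph if and only if $G=K_2$.
   Context: All graphs are simple, undirected and finite. The indicated coloring game on a graph $G$ with color set $\{1,\ldots,k\}$ is played by Ann and Ben. In every round Ann selects a previously uncolored vertex and Ben colors it with any color from $\{1,\ldots,k\}$ that has not been used on its neighbors. Ann's goal is a proper coloring of the whole graph; Ben wins if at some point there is an uncolored vertex having all colors $1,\ldots,k$ in its neighborhood. The indicated chromatic number $\chi_i(G)$ is the minimum $k$ for which Ann has a winning strategy on $G$, no matter how Ben plays. For $x\in V(G)$, $G-x$ is the graph obtained from $G$ by deleting $x$ and all edges incident with $x$. A graph $G$ is $k$-$\chi_i$-game-vertex-critical if $\chi_i(G)=k$ and $\chi_i(G-x)\neq\chi_i(G)$ for every $x\in V(G)$. $K_n$ is the complete graph of order $n$; equality of graphs means isomorphism. -}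

module Defs where

open import Data.Fin.Base using (Fin; zero; suc; punchIn; punchOut)
open import Data.Fin.Properties as Fin
  using (all?; any?; punchIn-injective; punchOut-injective; injective⇒≤)
open import Data.Maybe.Base using (Maybe; just; nothing)
open import Data.Maybe.Properties as Maybe using (just-injective)
open import Data.Nat.Base using (ℕ; zero; suc; pred; _+_; _≤_; _<_; s≤s)
open import Data.Nat.Induction using (<-rec; Acc; acc; <-wellFounded)
open import Data.Nat.Properties using (anyUpTo?; ≮⇒≥; 1+n≰n; n<1+n; +-monoʳ-<)
open import Data.Product.Base using (∃; _×_; _,_; proj₁; proj₂)
open import Data.Vec.Base using (Vec; []; _∷_; lookup; replicate; _[_]≔_)
open import Data.Vec.Properties using (lookup∘updateAt; lookup∘updateAt′; lookup-replicate)
open import Function.Base using (_∘_)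
open import Function.Bundles using (_↔_; _⇔_; Inverse)
open import Level using (0ℓ)
open import Relation.Binary.Core using (Rel)
open import Relation.Binary.Definitions using (Symmetric; Irreflexive; Decidable)
open import Relation.Binary.PropositionalEquality
  using (_≡_; _≢_; refl; sym; trans; subst; ≢-sym)
open import Relation.Nullary.Decidable.Core
  using (Dec; yes; no; ¬?; _×-dec_; _→-dec_; map′)
open import Relation.Nullary.Negation.Core using (¬_; contradiction)
open import Relation.Unary as Unary using (Pred)

record Graph (n : ℕ) : Set₁ where
  infix 4 _∼_ _∼?_
  field
    _∼_      : Rel (Fin n) 0ℓ
    ∼-sym    : Symmetric _∼_
    ∼-irrefl : Irreflexive _≡_ _∼_
    _∼?_     : Decidable _∼_

infix 4 _≅_

record _≅_ {m n : ℕ} (G : Graph m) (H : Graph n) : Set where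
  private
    module G = Graph G
    module H = Graph H
  field
    vertices : Fin m ↔ Fin n
    edges    : ∀ u v → (u G.∼ v) ⇔ (Inverse.to vertices u H.∼ Inverse.to vertices v)

K : (n : ℕ) → Graph n
K n = record
  { _∼_      = _≢_
  ; ∼-sym    = ≢-sym
  ; ∼-irrefl = λ u≡v u≢v → u≢v u≡v
  ; _∼?_     = λ u v → ¬? (u Fin.≟ v)
  }

infixl 6 _-_

-- punchIn x enumerates the vertices other than x.
_-_ : ∀ {n} → Graph n → Fin n → Graph (pred n)
_-_ {suc n} G x = record
  { _∼_      = λ u v → punchIn x u ∼ punchIn x v
  ; ∼-sym    = ∼-sym
  ; ∼-irrefl = λ { refl → ∼-irrefl refl }
  ; _∼?_     = λ u v → punchIn x u ∼? punchIn x v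
  }
  where open Graph G

-- A position of the game: nothing marks an uncoloured vertex.
Colouring : ℕ → ℕ → Set
Colouring n k = Vec (Maybe (Fin k)) n

uncoloured : ∀ {n k} → Colouring n k
uncoloured {n} = replicate n nothing

module Game {n : ℕ} (G : Graph n) (k : ℕ) where
  open Graph G

  Complete : Pred (Colouring n k) 0ℓ
  Complete c = ∀ v → lookup c v ≢ nothing

  Proper : Pred (Colouring n k) 0ℓ
  Proper c = ∀ u v → u ∼ v → ∀ a → lookup c u ≡ just a → lookup c v ≢ just a

  UsedNear : Colouring n k → Fin n → Pred (Fin k) 0ℓ
  UsedNear c v a = ∃ λ u → u ∼ v × lookup c u ≡ just a

  BenHasWon : Pred (Colouring n k) 0ℓ
  BenHasWon c = ∃ λ v → lookup c v ≡ nothing × (∀ a → UsedNear c v a)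

  -- A proof of AnnWins c is a winning strategy for Ann from position c: each
  -- select node names her vertex v and a continuation for each legal reply of
  -- Ben.  The premise ¬ BenHasWon c is needed: otherwise selecting a vertex
  -- with no legal colour would count as a win for Ann.
  data AnnWins (c : Colouring n k) : Set where
    finish : Complete c → Proper c → AnnWins c
    select : ¬ BenHasWon c →
             (v : Fin n) → lookup c v ≡ nothing →
             (∀ a → ¬ UsedNear c v a → AnnWins (c [ v ]≔ just a)) →
             AnnWins c

AnnHasWinningStrategy : ∀ {n} → Graph n → Pred ℕ 0ℓ
AnnHasWinningStrategy G k = Game.AnnWins G k uncoloured

module ExistenceOfMinimum where

  least : ∀ {P : Pred ℕ 0ℓ} → Unary.Decidable P →
          ∀ k → P k → ∃ λ m → P m × (∀ j → P j → m ≤ j)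
  least {P} P? = <-rec (λ k → P k → ∃ λ m → P m × (∀ j → P j → m ≤ j)) step
    where
    step : ∀ k → (∀ {i} → i < k → P i → ∃ λ m → P m × (∀ j → P j → m ≤ j)) →
           P k → ∃ λ m → P m × (∀ j → P j → m ≤ j)
    step k rec Pk with anyUpTo? P? k
    ... | yes (i , i<k , Pi) = rec i<k Pi
    ... | no  none           = k , Pk , λ j Pj → ≮⇒≥ λ j<k → none (j , j<k , Pj)

  blank : ∀ {k} → Maybe (Fin k) → ℕ
  blank nothing  = 1
  blank (just _) = 0

  blanks : ∀ {n k} → Colouring n k → ℕ
  blanks []       = 0
  blanks (x ∷ xs) = blank x + blanks xs

  blanks-decrease : ∀ {n k} (c : Colouring n k) v a → lookup c v ≡ nothing →
                    blanks (c [ v ]≔ just a) < blanks c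
  blanks-decrease (nothing ∷ c) zero    a refl = n<1+n _
  blanks-decrease (x ∷ c)       (suc v) a eq   = +-monoʳ-< (blank x) (blanks-decrease c v a eq)

  nothing≢just : ∀ {k} {a : Fin k} → nothing ≢ just a
  nothing≢just ()

  module _ {n : ℕ} (G : Graph n) (k : ℕ) where
    open Graph G
    open Game G k

    infix 4 _≟ᶜ_
    _≟ᶜ_ : Decidable {A = Maybe (Fin k)} _≡_
    _≟ᶜ_ = Maybe.≡-dec Fin._≟_

    complete? : Unary.Decidable Complete
    complete? c = all? λ v → ¬? (lookup c v ≟ᶜ nothing)

    proper? : Unary.Decidable Proper
    proper? c = all? λ u → all? λ v → (u ∼? v) →-dec all? λ a →
      (lookup c u ≟ᶜ just a) →-dec ¬? (lookup c v ≟ᶜ just a)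

    usedNear? : ∀ c v → Unary.Decidable (UsedNear c v)
    usedNear? c v a = any? λ u → (u ∼? v) ×-dec (lookup c u ≟ᶜ just a)

    benHasWon? : Unary.Decidable BenHasWon
    benHasWon? c = any? λ v → (lookup c v ≟ᶜ nothing) ×-dec all? (usedNear? c v)

    annWins?′ : ∀ c → Acc _<_ (blanks c) → Dec (AnnWins c)
    annWins?′ c (acc rs) with complete? c ×-dec proper? c
    ... | yes (full , prop) = yes (finish full prop)
    ... | no ¬finished with benHasWon? c
    ...   | yes won = no λ where
              (finish full prop) → ¬finished (full , prop)
              (select ¬won _ _ _) → ¬won won
    ...   | no ¬won = map′ to from (any? move?)
      where
      Move : Pred (Fin n) 0ℓ
      Move v = ∃ λ (_ : lookup c v ≡ nothing) →
                 ∀ a → ¬ UsedNear c v a → AnnWins (c [ v ]≔ just a)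

      move? : Unary.Decidable Move
      move? v with lookup c v ≟ᶜ nothing
      ... | no  v≢nothing = no (v≢nothing ∘ proj₁)
      ... | yes v≡nothing = map′ (v≡nothing ,_) proj₂
              (all? λ a → ¬? (usedNear? c v a) →-dec
                annWins?′ (c [ v ]≔ just a) (rs (blanks-decrease c v a v≡nothing)))

      to : ∃ Move → AnnWins c
      to (v , v≡nothing , strategy) = select ¬won v v≡nothing strategy

      from : AnnWins c → ∃ Move
      from (finish full prop)              = contradiction (full , prop) ¬finished
      from (select _ v v≡nothing strategy) = v , v≡nothing , strategy

    annWins? : Unary.Decidable AnnWins
    annWins? c = annWins?′ c (<-wellFounded (blanks c))

    proper-uncoloured : Proper uncoloured
    proper-uncoloured u v _ a u≡a _ =
      nothing≢just (trans (sym (lookup-replicate u nothing)) u≡a)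

    proper-step : ∀ c v a → Proper c → ¬ UsedNear c v a → Proper (c [ v ]≔ just a)
    proper-step c v a prop legal x y x∼y b x≡b y≡b with x Fin.≟ v | y Fin.≟ v
    ... | yes refl | yes refl = ∼-irrefl refl x∼y
    ... | yes refl | no y≢v
      with refl ← just-injective (trans (sym (lookup∘updateAt v c)) x≡b)
      = legal (y , ∼-sym x∼y , trans (sym (lookup∘updateAt′ y v y≢v c)) y≡b)
    ... | no x≢v | yes refl
      with refl ← just-injective (trans (sym (lookup∘updateAt v c)) y≡b)
      = legal (x , x∼y , trans (sym (lookup∘updateAt′ x v x≢v c)) x≡b)
    ... | no x≢v | no y≢v =
      prop x y x∼y b (trans (sym (lookup∘updateAt′ x v x≢v c)) x≡b)
                     (trans (sym (lookup∘updateAt′ y v y≢v c)) y≡b)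

  -- With as many colours as vertices, an uncoloured vertex never sees them all.
  benCannotWin : ∀ {n} (G : Graph n) c → ¬ Game.BenHasWon G n c
  benCannotWin {suc n} G c (v , v≡nothing , used) = 1+n≰n (injective⇒≤ h-injective)
    where
    v≢ : ∀ a → v ≢ proj₁ (used a)
    v≢ a v≡u = nothing≢just
      (trans (sym v≡nothing) (subst (λ w → lookup c w ≡ just a) (sym v≡u) (proj₂ (proj₂ (used a)))))

    h : Fin (suc n) → Fin n
    h a = punchOut (v≢ a)

    h-injective : ∀ {a b} → h a ≡ h b → a ≡ b
    h-injective {a} {b} ha≡hb = just-injective (trans (sym (proj₂ (proj₂ (used a))))
      (subst (λ w → lookup c w ≡ just b)
             (sym (punchOut-injective (v≢ a) (v≢ b) ha≡hb))
             (proj₂ (proj₂ (used b)))))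

  annWins-order : ∀ {n} (G : Graph n) → AnnHasWinningStrategy G n
  annWins-order {n} G = play uncoloured (proper-uncoloured G n) (<-wellFounded _)
    where
    open Game G n

    play : ∀ c → Proper c → Acc _<_ (blanks c) → AnnWins c
    play c prop (acc rs) with any? (λ v → _≟ᶜ_ G n (lookup c v) nothing)
    ... | no  none            = finish (λ v v≡nothing → none (v , v≡nothing)) prop
    ... | yes (v , v≡nothing) = select (benCannotWin G c) v v≡nothing λ a legal →
      play _ (proper-step G n c v a prop legal) (rs (blanks-decrease c v a v≡nothing))

open ExistenceOfMinimum using (least; annWins?; annWins-order)

minimumColours : ∀ {n} (G : Graph n) →
                 ∃ λ k → AnnHasWinningStrategy G k ×
                         (∀ j → AnnHasWinningStrategy G j → k ≤ j)
minimumColours {n} G = least (λ k → annWins? G k uncoloured) n (annWins-order G)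

χᵢ : ∀ {n} → Graph n → ℕ
χᵢ G = proj₁ (minimumColours G)

infix 4 _-χᵢ-GameVertexCritical_

_-χᵢ-GameVertexCritical_ : ∀ {n} → ℕ → Graph n → Set
k -χᵢ-GameVertexCritical G = χᵢ G ≡ k × (∀ x → χᵢ (G - x) ≢ χᵢ G)

{-# OPTIONS --safe #-}

-- Ann wins with two colours on every 2-colourable graph: she keeps a proper
-- 2-colouring g extending the position and asks for an uncoloured vertex with
-- a coloured neighbour as long as there is one, which forces Ben to follow g.
-- When there is none, no edge joins coloured and uncoloured vertices, so g may
-- be flipped on the uncoloured ones to match any reply of Ben.  Hence χᵢ G = 2
-- means that G is 2-colourable and has an edge u ∼ v; deleting any third vertex
-- would keep both properties, so a critical G has no vertices but u and v.

module Submission where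

open import Data.Fin.Base using (Fin; zero; suc; opposite; punchIn; punchOut)
open import Data.Fin.Properties as Fin
  using (any?; ¬∀⟶∃¬; opposite-involutive; punchIn-punchOut)
open import Data.Fin.Permutation using (↔⇒≡)
open import Data.Maybe.Base using (Maybe; just; nothing; fromMaybe)
open import Data.Maybe.Properties as Maybe using (just-injective)
open import Data.Nat.Base using (ℕ; zero; suc; _≤_; _<_; z≤n; s≤s)
open import Data.Nat.Induction using (Acc; acc; <-wellFounded)
open import Data.Nat.Properties using (≤-antisym; <⇒≢)
open import Data.Product.Base using (∃; ∃₂; _×_; _,_; proj₁; proj₂)
open import Data.Sum.Base using (_⊎_; inj₁; inj₂)
open import Data.Unit.Base using (⊤; tt)
open import Data.Vec.Base using (lookup; _[_]≔_)
open import Data.Vec.Properties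
  using (lookup∘updateAt; lookup∘updateAt′; lookup-replicate)
open import Function.Base using (_∘_)
open import Function.Bundles
  using (_⇔_; mk⇔; mk↔ₛ′; Inverse; Equivalence; Injection)
open import Function.Properties.Inverse using (↔⇒↣)
open import Level using (0ℓ)
open import Relation.Binary.Definitions using (DecidableEquality)
open import Relation.Binary.PropositionalEquality
  using (_≡_; _≢_; refl; sym; trans; cong; subst; subst₂)
open import Relation.Nullary.Decidable.Core using (yes; no; _×-dec_)
open import Relation.Nullary.Negation.Core using (¬_; contradiction)
open import Relation.Unary using (Pred)
open import Defs
open ExistenceOfMinimum
  using (blanks; blanks-decrease; nothing≢just; usedNear?; proper-uncoloured; proper-step)

private
  variable
    n k : ℕ

-- Two colours, proper maps and positions extended by them

≢⇒≡opposite : {a b : Fin 2} → a ≢ b → a ≡ opposite b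
≢⇒≡opposite {zero}     {zero}     a≢b = contradiction refl a≢b
≢⇒≡opposite {zero}     {suc zero} a≢b = refl
≢⇒≡opposite {suc zero} {zero}     a≢b = refl
≢⇒≡opposite {suc zero} {suc zero} a≢b = contradiction refl a≢b

opposite-injective : {a b : Fin n} → opposite a ≡ opposite b → a ≡ b
opposite-injective {a = a} {b} eq =
  trans (sym (opposite-involutive a)) (trans (cong opposite eq) (opposite-involutive b))

Fin1-irrelevant : (a b : Fin 1) → a ≡ b
Fin1-irrelevant zero zero = refl

_≟ᵐ_ : DecidableEquality (Maybe (Fin k))
_≟ᵐ_ = Maybe.≡-dec Fin._≟_

ProperMap : Graph n → (k : ℕ) → Pred (Fin n → Fin k) 0ℓ
ProperMap G k g = ∀ {u v} → u ∼ v → g u ≢ g v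
  where open Graph G

Colourable : Graph n → ℕ → Set
Colourable G k = ∃ (ProperMap G k)

Edgeless : Graph n → Set
Edgeless G = ∀ {u v} → ¬ u ∼ v
  where open Graph G

delete-colourable : {G : Graph n} → Colourable G k → ∀ x → Colourable (G - x) k
delete-colourable {n = suc n} (g , proper) x = g ∘ punchIn x , proper

Extends : (Fin n → Fin k) → Colouring n k → Set
Extends g c = ∀ {w a} → lookup c w ≡ just a → g w ≡ a

extends-uncoloured : (g : Fin n → Fin k) → Extends g uncoloured
extends-uncoloured g {w} eq =
  contradiction (trans (sym (lookup-replicate w nothing)) eq) nothing≢just

extends-step : ∀ {g : Fin n → Fin k} c {v a} →
               Extends g c → g v ≡ a → Extends g (c [ v ]≔ just a)
extends-step c {v} ext gv≡a {w} eq with w Fin.≟ v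
... | yes refl = trans gv≡a (just-injective (trans (sym (lookup∘updateAt v c)) eq))
... | no  w≢v  = ext (trans (sym (lookup∘updateAt′ w v w≢v c)) eq)

-- Strategies from invariants, colourings from strategies

module _ (G : Graph n) (k : ℕ) where
  open Graph G
  open Game G k

  -- Induction on the number of uncoloured vertices. Properness is carried along by `proper-step`,
  -- so `I` only has to exclude a win of Ben and supply the next vertex.
  annWins-invariant : (I : Pred (Colouring n k) 0ℓ) →
    (∀ c → I c → ¬ BenHasWon c) →
    (∀ c → I c → ∀ {w} → lookup c w ≡ nothing →
       ∃ λ v → lookup c v ≡ nothing × (∀ a → ¬ UsedNear c v a → I (c [ v ]≔ just a))) →
    I uncoloured → AnnHasWinningStrategy G k
  annWins-invariant I safe move start =
    play uncoloured start (proper-uncoloured G k) (<-wellFounded _)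
    where
    play : ∀ c → I c → Proper c → Acc _<_ (blanks c) → AnnWins c
    play c Ic proper (acc rs) with any? (λ v → lookup c v ≟ᵐ nothing)
    ... | no  none            = finish (λ v eq → none (v , eq)) proper
    ... | yes (w , w≡nothing) =
      let v , v≡nothing , reply = move c Ic w≡nothing in
      select (safe c Ic) v v≡nothing λ a legal →
        play _ (reply a legal) (proper-step G k c v a proper legal)
             (rs (blanks-decrease c v a v≡nothing))

  -- Follow one branch of the strategy: as Ben has not won, he has a legal reply at `v`, and the
  -- play continues down to a `finish`, whose position is a colouring.
  annWins⇒colourable : ∀ {c} → AnnWins c → Colourable G k
  annWins⇒colourable {c} (finish complete proper) = colour , colour-proper
    where
    coloured : ∀ v → ∃ λ a → lookup c v ≡ just a
    coloured v with lookup c v in eq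
    ... | just a  = a , refl
    ... | nothing = contradiction eq (complete v)

    colour : Fin n → Fin k
    colour v = proj₁ (coloured v)

    colour-proper : ProperMap G k colour
    colour-proper {u} {v} u∼v eq =
      proper u v u∼v (colour u) (proj₂ (coloured u))
        (trans (proj₂ (coloured v)) (cong just (sym eq)))
  annWins⇒colourable {c} (select ¬won v v≡nothing strategy)
    with a , legal ← ¬∀⟶∃¬ k _ (usedNear? G k c v) (λ used → ¬won (v , v≡nothing , used))
    = annWins⇒colourable (strategy a legal)

-- The game with one and with two colours

module _ (G : Graph n) where
  open Graph G

  edgeless⇒annWins : Edgeless G → AnnHasWinningStrategy G 1
  edgeless⇒annWins edgeless = annWins-invariant G 1 (λ _ → ⊤)
    -- A win of Ben requires the single colour on a neighbour, hence an edge.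
    (λ _ _ (_ , _ , used) → edgeless (proj₁ (proj₂ (used zero))))
    (λ _ _ w≡nothing → _ , w≡nothing , λ _ _ → tt)
    tt

  edge⇒2≤ : ∀ {u v} → u ∼ v → Colourable G k → 2 ≤ k
  edge⇒2≤ {zero}        {u} u∼v (g , proper) with () ← g u
  edge⇒2≤ {suc zero}        u∼v (g , proper) =
    contradiction (Fin1-irrelevant _ _) (proper u∼v)
  edge⇒2≤ {suc (suc k)}     u∼v (g , proper) = s≤s (s≤s z≤n)

  module _ (g : Fin n → Fin 2) (c : Colouring n 2) where
    open Game G 2

    -- Coloured vertices are read from `c` rather than from `g`, which makes `flip-extends` hold for
    -- every `g`.
    flipUncoloured : Fin n → Fin 2
    flipUncoloured w = fromMaybe (opposite (g w)) (lookup c w)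

    flip-extends : Extends flipUncoloured c
    flip-extends eq rewrite eq = refl

    flip-uncoloured : ∀ {w} → lookup c w ≡ nothing → flipUncoloured w ≡ opposite (g w)
    flip-uncoloured eq rewrite eq = refl

    -- Edges inside the coloured part keep their colours from `g`, edges inside the uncoloured part
    -- have both ends flipped, and `isolated` excludes mixed edges.
    flip-proper : ProperMap G 2 g → Extends g c →
                  (∀ {v a} → lookup c v ≡ nothing → ¬ UsedNear c v a) →
                  ProperMap G 2 flipUncoloured
    flip-proper proper ext isolated {u} {w} u∼w eq
      with lookup c u in cu | lookup c w in cw
    ... | just a  | just b  = proper u∼w (trans (ext cu) (trans eq (sym (ext cw))))
    ... | just a  | nothing = isolated cw (u , u∼w , cu)
    ... | nothing | just b  = isolated cu (w , ∼-sym u∼w , cw)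
    ... | nothing | nothing = proper u∼w (opposite-injective eq)

  colourable⇒annWins : Colourable G 2 → AnnHasWinningStrategy G 2
  colourable⇒annWins (g₀ , proper₀) =
    annWins-invariant G 2 Extendable safe move (g₀ , proper₀ , extends-uncoloured g₀)
    where
    open Game G 2

    -- `g` is quantified inside the invariant because a flip replaces it during play.
    Extendable : Pred (Colouring n 2) 0ℓ
    Extendable c = ∃ λ g → ProperMap G 2 g × Extends g c

    safe : ∀ c → Extendable c → ¬ BenHasWon c
    safe c (g , proper , ext) (v , _ , used) =
      -- Were all colours used near `v`, the colour `g v` would sit on a neighbour `u`, forcing
      -- `g u ≡ g v` across an edge.
      let u , u∼v , cu≡gv = used (g v) in proper u∼v (ext cu≡gv)

    move : ∀ c → Extendable c → ∀ {w} → lookup c w ≡ nothing →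
           ∃ λ v → lookup c v ≡ nothing ×
                   (∀ a → ¬ UsedNear c v a → Extendable (c [ v ]≔ just a))
    move c (g , proper , ext) {w} w≡nothing
      with any? (λ v → (lookup c v ≟ᵐ nothing) ×-dec any? (usedNear? G 2 c v))
    ... | yes (v , v≡nothing , a , u , u∼v , cu≡a) = v , v≡nothing , forced
      where
      forced : ∀ b → ¬ UsedNear c v b → Extendable (c [ v ]≔ just b)
      -- Both `g v` and `b` differ from the colour of `u`, and only one other colour exists.
      forced b legal = g , proper , extends-step c ext (trans gv≡ (sym b≡))
        where
        gv≡ : g v ≡ opposite (g u)
        gv≡ = ≢⇒≡opposite (proper (∼-sym u∼v))

        b≡ : b ≡ opposite (g u)
        b≡ = ≢⇒≡opposite λ b≡gu →
          legal (u , u∼v , trans cu≡a (cong just (sym (trans b≡gu (ext cu≡a)))))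
    ... | no none = w , w≡nothing , free
      where
      free : ∀ b → ¬ UsedNear c w b → Extendable (c [ w ]≔ just b)
      free b _ with b Fin.≟ g w
      ... | yes b≡gw = g , proper , extends-step c ext (sym b≡gw)
      -- `none` provides the isolation that `flip-proper` asks for, and `b` is the flipped colour of
      -- `w`.
      ... | no  b≢gw =
        flipUncoloured g c ,
        flip-proper g c proper ext (λ v≡nothing used → none (_ , v≡nothing , _ , used)) ,
        extends-step c (flip-extends g c)
          (trans (flip-uncoloured g c w≡nothing) (sym (≢⇒≡opposite b≢gw)))

  -- Graphs with indicated chromatic number 2

  χᵢ-minimal : AnnHasWinningStrategy G k → χᵢ G ≤ k
  χᵢ-minimal = proj₂ (proj₂ (minimumColours G)) _

  χᵢ-colourable : Colourable G (χᵢ G)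
  χᵢ-colourable = annWins⇒colourable G _ (proj₁ (proj₂ (minimumColours G)))

  χᵢ≡2 : ∀ {u v} → u ∼ v → Colourable G 2 → χᵢ G ≡ 2
  χᵢ≡2 u∼v colourable =
    ≤-antisym (χᵢ-minimal (colourable⇒annWins colourable)) (edge⇒2≤ u∼v χᵢ-colourable)

  edgeless⇒χᵢ≢2 : Edgeless G → χᵢ G ≢ 2
  edgeless⇒χᵢ≢2 edgeless = <⇒≢ (s≤s (χᵢ-minimal (edgeless⇒annWins edgeless)))

  χᵢ≡2⇒edge : χᵢ G ≡ 2 → ∃₂ _∼_
  χᵢ≡2⇒edge χ≡2 with any? (λ u → any? (u ∼?_))
  ... | yes edge = edge
  ... | no  none = contradiction χ≡2 (edgeless⇒χᵢ≢2 λ u∼v → none (_ , _ , u∼v))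

-- Vertex deletion and criticality

delete-edge : (G : Graph n) → let open Graph G in
              ∀ {u v} x → x ≢ u → x ≢ v → u ∼ v → ∃₂ (Graph._∼_ (G - x))
delete-edge {n = suc n} G x x≢u x≢v u∼v =
  punchOut x≢u , punchOut x≢v ,
  subst₂ _∼_ (sym (punchIn-punchOut x≢u)) (sym (punchIn-punchOut x≢v)) u∼v
  where open Graph G

critical⇒endpoint : (G : Graph n) → let open Graph G in
                    2 -χᵢ-GameVertexCritical G → ∀ {u v} → u ∼ v → ∀ x → x ≡ u ⊎ x ≡ v
critical⇒endpoint G (χ≡2 , critical) {u} {v} u∼v x with x Fin.≟ u | x Fin.≟ v
... | yes x≡u | _       = inj₁ x≡u
... | no  _   | yes x≡v = inj₂ x≡v
... | no  x≢u | no  x≢v =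
  let _ , _ , edge = delete-edge G x x≢u x≢v u∼v
      colourable   = delete-colourable {G = G} (subst (Colourable G) χ≡2 (χᵢ-colourable G)) x
  in contradiction (trans (χᵢ≡2 (G - x) edge colourable) (sym χ≡2)) (critical x)

spanningEdge⇒≅K₂ : (G : Graph n) → let open Graph G in
                   ∀ {u v} → u ∼ v → (∀ x → x ≡ u ⊎ x ≡ v) → G ≅ K 2
spanningEdge⇒≅K₂ {n} G {u} {v} u∼v endpoint = record
  { vertices = mk↔ₛ′ to from to∘from from∘to
  ; edges    = λ x y → mk⇔ (λ x∼y tx≡ty → ∼-irrefl (to-injective tx≡ty) x∼y) (adjacent x y)
  }
  where
  open Graph G

  to : Fin n → Fin 2
  to x with endpoint x
  ... | inj₁ _ = zero
  ... | inj₂ _ = suc zero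

  from : Fin 2 → Fin n
  from zero       = u
  from (suc zero) = v

  -- `endpoint` might report the other alternative at `u` or `v`, but that would make `u∼v` a loop.
  to∘from : ∀ i → to (from i) ≡ i
  to∘from zero with endpoint u
  ... | inj₁ _   = refl
  ... | inj₂ u≡v = contradiction u∼v (∼-irrefl u≡v)
  to∘from (suc zero) with endpoint v
  ... | inj₁ v≡u = contradiction u∼v (∼-irrefl (sym v≡u))
  ... | inj₂ _   = refl

  from∘to : ∀ x → from (to x) ≡ x
  from∘to x with endpoint x
  ... | inj₁ x≡u = sym x≡u
  ... | inj₂ x≡v = sym x≡v

  to-injective : ∀ {x y} → to x ≡ to y → x ≡ y
  to-injective {x} {y} eq = trans (sym (from∘to x)) (trans (cong from eq) (from∘to y))

  adjacent : ∀ x y → to x ≢ to y → x ∼ y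
  adjacent x y tx≢ty with endpoint x | endpoint y
  ... | inj₁ refl | inj₁ refl = contradiction refl tx≢ty
  ... | inj₁ refl | inj₂ refl = u∼v
  ... | inj₂ refl | inj₁ refl = ∼-sym u∼v
  ... | inj₂ refl | inj₂ refl = contradiction refl tx≢ty

≅K₂⇒critical : (G : Graph n) → G ≅ K 2 → 2 -χᵢ-GameVertexCritical G
-- The bijection forces `n` to be 2, so `G - x` has a single vertex and is edgeless.
≅K₂⇒critical G iso with refl ← ↔⇒≡ (_≅_.vertices iso) = χ≡2 , critical
  where
  open Graph G
  open _≅_ iso
  open Inverse vertices using (to)

  0∼1 : zero ∼ suc zero
  0∼1 = Equivalence.from (edges _ _) λ eq →
    contradiction (Injection.injective (↔⇒↣ vertices) eq) λ ()

  χ≡2 : χᵢ G ≡ 2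
  -- Adjacency in `K 2` is inequality, so the isomorphism itself is a proper 2-colouring.
  χ≡2 = χᵢ≡2 G 0∼1 (to , λ {u} {v} → Equivalence.to (edges u v))

  critical : ∀ x → χᵢ (G - x) ≢ χᵢ G
  critical x eq = edgeless⇒χᵢ≢2 (G - x)
    (λ {u} {v} → Graph.∼-irrefl (G - x) (Fin1-irrelevant u v)) (trans eq χ≡2)

proposition12 : (n : ℕ) (G : Graph n) → 2 -χᵢ-GameVertexCritical G ⇔ G ≅ K 2
proposition12 n G = mk⇔
  (λ critical → let _ , _ , u∼v = χᵢ≡2⇒edge G (proj₁ critical) in
    spanningEdge⇒≅K₂ G u∼v (critical⇒endpoint G critical u∼v))
  (≅K₂⇒critical G)
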